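{- The axiomatic system $\mathbf{KB}^\circ$ is sound and strongly complete with respect to the class of symmetric frames ($\mathcal{B}$-frames). That is, with $F$ the class of symmetric frames: every theorem of $\mathbf{KB}^\circ$ is valid on $F$ (soundness), and for every set $\Gamma\cup\{\phi\}$ of $\mathcal{L}(\circ)$-formulas, if $\Gamma\vDash_F\phi$ then $\Gamma\vdash_{\mathbf{KB}^\circ}\phi$ (strong completeness).
   Context: Let $\mathbf{P}$ be a set of propositional variables, with $p,q\in\mathbf{P}$ distinct. The language $\mathcal{L}(\circ)$ is given by $\phi::=r\mid\neg\phi\mid(\phi\land\phi)\mid\circ\phi$ with $r\in\mathbf{P}$; other Boolean connectives and $\top$ are the usual abbreviations. A frame is $\langle S,R\rangle$ with $S$ a nonempty set and $R\subseteq S\times S$; it is symmetric if $R$ is. A model based on a frame is $\mathcal{M}=\langle S,R,V\rangle$ with $V:\mathbf{P}\to\mathcal{P}(S)$. Satisfaction: $\mathcal{M},s\vDash r$ iff $s\in V(r)$; Booleans as usual; $\mathcal{M},s\vDash\circ\phi$ iff ($\mathcal{M},s\vDash\phi$ implies that $\mathcal{M},t\vDash\phi$ for all $t$ with $sRt$). For a class $F$ of frames, $\phi$ is valid on $F$ if $\mathcal{M},s\vDash\phi$ for every model $\mathcal{M}$ based on a frame in $F$ and every $s$ in $\mathcal{M}$; $\Gamma\vDash_F\phi$ means: for every model $\mathcal{M}$ based on a frame in $F$ and every $s$ in $\mathcal{M}$, if $\mathcal{M},s\vDash\gamma$ for all $\gamma\in\Gamma$ then $\mathcal{M},s\vDash\phi$.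 The system $\mathbf{K}^\circ$ has as axioms all propositional tautologies, $\circ\top$, $\neg p\to\circ p$, and $\circ p\land\circ q\to\circ(p\land q)$, and as inference rules uniform substitution, modus ponens, and the rule: from $\phi\to\psi$ infer $\circ\phi\land\phi\to\circ\psi$. The system $\mathbf{KB}^\circ$ is $\mathbf{K}^\circ$ plus the axiom $p\to\circ(\circ\neg p\to p)$. A derivation from $\Gamma$ to $\phi$ in a system, written $\Gamma\vdash\phi$ (with the system as subscript), is a finite sequence of $\mathcal{L}(\circ)$-formulas (ending in $\phi$) in which each formula is either an instantiation of an axiom, or an element of $\Gamma$, or the result of applying an inference rule to prior formulas in the sequence. A theorem is a formula $\phi$ for which there is a derivation from $\emptyset$ to $\phi$. -}

module Defs where

open import Data.Bool using (Bool; true; not) renaming (_∧_ to _&&_)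
open import Data.List using (List; []; _∷_)
open import Data.List.Membership.Propositional using () renaming (_∈_ to _∈ˡ_)
open import Data.Product using (_×_; ∃)
open import Level using (Level; suc; _⊔_)
open import Relation.Binary using (Rel; Symmetric)
open import Relation.Binary.PropositionalEquality using (_≡_)
open import Relation.Nullary using (¬_)
open import Relation.Unary using (Pred; _∈_)

private
  variable
    ℓ c : Level
    P : Set ℓ

infix  30 ~_ ∘_
infixr 25 _∧_
infixr 20 _⇒_

data Form (P : Set ℓ) : Set ℓ where
  var : P → Form P
  ~_  : Form P → Form P
  _∧_ : Form P → Form P → Form P
  ∘_  : Form P → Form P

_⇒_ : Form P → Form P → Form P
φ ⇒ ψ = ~ (φ ∧ ~ ψ)

-- ⊤ is not primitive, so it is built from a chosen variable.
top : P → Form P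
top r = ~ (var r ∧ ~ var r)

_[_] : Form P → (P → Form P) → Form P
var r   [ σ ] = σ r
(~ φ)   [ σ ] = ~ (φ [ σ ])
(φ ∧ ψ) [ σ ] = (φ [ σ ]) ∧ (ψ [ σ ])
(∘ φ)   [ σ ] = ∘ (φ [ σ ])

record Frame ℓ : Set (suc ℓ) where
  field
    S        : Set ℓ
    nonempty : S
    R        : Rel S ℓ

record Model (P : Set ℓ) : Set (suc ℓ) where
  field
    frame : Frame ℓ
  open Frame frame public
  field
    V : P → Pred S ℓ

infix 4 _,_⊨_

_,_⊨_ : {P : Set ℓ} (M : Model P) → Model.S M → Form P → Set ℓ
M , s ⊨ var r   = s ∈ Model.V M r
M , s ⊨ ~ φ     = ¬ (M , s ⊨ φ)
M , s ⊨ (φ ∧ ψ) = (M , s ⊨ φ) × (M , s ⊨ ψ)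
M , s ⊨ ∘ φ     = M , s ⊨ φ → ∀ t → Model.R M s t → M , t ⊨ φ

SymmetricFrame : Pred (Frame ℓ) ℓ
SymmetricFrame F = Symmetric (Frame.R F)

ValidOn : {P : Set ℓ} → Pred (Frame ℓ) c → Form P → Set (suc ℓ ⊔ c)
ValidOn {P = P} F φ = (M : Model P) → Model.frame M ∈ F → ∀ s → M , s ⊨ φ

infix 4 _⊨[_]_

_⊨[_]_ : {P : Set ℓ} → Pred (Form P) ℓ → Pred (Frame ℓ) c → Form P → Set (suc ℓ ⊔ c)
_⊨[_]_ {P = P} Γ F φ =
  (M : Model P) → Model.frame M ∈ F → ∀ s → (∀ γ → γ ∈ Γ → M , s ⊨ γ) → M , s ⊨ φ

-- Truth-table evaluation. Variables and formulas ∘ φ count as propositional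
-- atoms, so v is only ever consulted on those.
eval : (Form P → Bool) → Form P → Bool
eval v (var r) = v (var r)
eval v (~ φ)   = not (eval v φ)
eval v (φ ∧ ψ) = eval v φ && eval v ψ
eval v (∘ φ)   = v (∘ φ)

Tautology : {P : Set ℓ} → Pred (Form P) ℓ
Tautology φ = ∀ v → eval v φ ≡ true

data K° {P : Set ℓ} (p q : P) : Pred (Form P) ℓ where
  taut : ∀ {φ} → Tautology φ → K° p q φ
  ∘⊤   : K° p q (∘ top p)
  ¬→∘  : K° p q (~ var p ⇒ ∘ var p)
  ∘∧   : K° p q (∘ var p ∧ ∘ var q ⇒ ∘ (var p ∧ var q))

data KB° {P : Set ℓ} (p q : P) : Pred (Form P) ℓ where
  k° : ∀ {φ} → K° p q φ → KB° p q φ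
  B  : KB° p q (var p ⇒ ∘ (∘ ~ var p ⇒ var p))

-- Ax is the set of axioms. The systems share their inference rules, so they are
-- identified with their axiom sets. All rules, including uniform substitution,
-- may be applied to any earlier formula φs, also one that depends on Γ.
data Step {P : Set ℓ} (Ax Γ : Pred (Form P) ℓ) (φs : List (Form P)) : Pred (Form P) ℓ where
  axiom : ∀ {φ} → φ ∈ Ax → ∀ σ → Step Ax Γ φs (φ [ σ ])
  hyp   : ∀ {φ} → φ ∈ Γ → Step Ax Γ φs φ
  sub   : ∀ {φ} → φ ∈ˡ φs → ∀ σ → Step Ax Γ φs (φ [ σ ])
  mp    : ∀ {φ ψ} → (φ ⇒ ψ) ∈ˡ φs → φ ∈ˡ φs → Step Ax Γ φs ψ
  mono  : ∀ {φ ψ} → (φ ⇒ ψ) ∈ˡ φs → Step Ax Γ φs (∘ φ ∧ φ ⇒ ∘ ψ)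

-- The sequence is listed in reverse: its last formula is the head.
data Derivation {P : Set ℓ} (Ax Γ : Pred (Form P) ℓ) : Pred (List (Form P)) ℓ where
  []  : Derivation Ax Γ []
  _∷_ : ∀ {φ φs} → Step Ax Γ φs φ → Derivation Ax Γ φs → Derivation Ax Γ (φ ∷ φs)

infix 4 _⊢[_]_

_⊢[_]_ : {P : Set ℓ} → Pred (Form P) ℓ → Pred (Form P) ℓ → Form P → Set ℓ
Γ ⊢[ Ax ] φ = ∃ λ φs → Derivation Ax Γ (φ ∷ φs)

{-# OPTIONS --safe #-}
-- Uniform substitution may be applied to hypotheses, so the formulas derivable
-- from Γ form a logic L closed under substitution. To refute an underivable φ it
-- is therefore enough to work in a countable language: name the finitely many
-- variables of φ by natural numbers and pull L back along the naming. There
-- Lindenbaum's lemma needs only excluded middle and no form of choice. The worlds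
-- of the canonical model are the Boolean valuations verifying the pulled-back
-- logic, and w sees u when u verifies every χ such that w verifies χ and ∘ χ.
module Submission where

open import Defs
open import Axiom.ExcludedMiddle using (ExcludedMiddle)
open import Data.Bool using (Bool; true; false; not)
open import Data.List using (List; []; _∷_; _++_; map; cartesianProductWith)
open import Data.List.Membership.Propositional using () renaming (_∈_ to _∈ˡ_)
open import Data.List.Membership.Propositional.Properties
  using (∈-++⁺ˡ; ∈-++⁺ʳ; ∈-map⁺; ∈-cartesianProductWith⁺)
open import Data.List.Relation.Unary.Any using (here; there)
open import Data.Nat using (ℕ; zero; suc; _⊔_; _≤_; _≤′_; ≤′-reflexive; ≤′-step)
open import Data.Nat.Properties using (≤⇒≤′; m≤m⊔n; m≤n⊔m)
open import Data.Product using (_×_; _,_; proj₁; proj₂; ∃; Σ-syntax)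
open import Data.Sum using (_⊎_; inj₁; inj₂)
open import Function using (_∘′_; id)
open import Function.Bundles using (_⇔_; mk⇔; module Equivalence)
open import Level using (Level; Lift; lift; lower)
open import Relation.Binary.PropositionalEquality
  using (_≡_; _≢_; refl; sym; trans; cong; cong₂; subst)
open import Relation.Nullary using (¬_; Dec; yes; no; does; contradiction)
open import Relation.Nullary.Decidable using (decidable-stable)
open import Relation.Unary using (Pred; _∈_; _⊆_)
open import Relation.Unary.Polymorphic using (∅)

open Equivalence using (to; from)

private
  variable
    ℓ x y : Level
    X : Set x
    Y : Set y
    φ ψ χ : Form X

-- Substitution

rename : (X → Y) → Form X → Form Y
rename f (var r) = var (f r)
rename f (~ φ)   = ~ rename f φ
rename f (φ ∧ ψ) = rename f φ ∧ rename f ψ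
rename f (∘ φ)   = ∘ rename f φ

rename-∘ : ∀ (g : Y → X) (f : X → Y) φ → rename g (rename f φ) ≡ φ [ var ∘′ g ∘′ f ]
rename-∘ g f (var r) = refl
rename-∘ g f (~ φ)   = cong ~_ (rename-∘ g f φ)
rename-∘ g f (φ ∧ ψ) = cong₂ _∧_ (rename-∘ g f φ) (rename-∘ g f ψ)
rename-∘ g f (∘ φ)   = cong ∘_ (rename-∘ g f φ)

vars : Form X → List X
vars (var r) = r ∷ []
vars (~ φ)   = vars φ
vars (φ ∧ ψ) = vars φ ++ vars ψ
vars (∘ φ)   = vars φ

[]-id : ∀ (φ : Form X) {σ : X → Form X} →
        (∀ {r} → r ∈ˡ vars φ → σ r ≡ var r) → φ [ σ ] ≡ φ
[]-id (var r) eq = eq (here refl)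
[]-id (~ φ)   eq = cong ~_ ([]-id φ eq)
[]-id (φ ∧ ψ) eq = cong₂ _∧_ ([]-id φ (eq ∘′ ∈-++⁺ˡ)) ([]-id ψ (eq ∘′ ∈-++⁺ʳ (vars φ)))
[]-id (∘ φ)   eq = cong ∘_ ([]-id φ eq)

eval-rename : ∀ (f : X → Y) v φ → eval v (rename f φ) ≡ eval (v ∘′ rename f) φ
eval-rename f v (var r) = refl
eval-rename f v (~ φ)   = cong not (eval-rename f v φ)
eval-rename f v (φ ∧ ψ) = cong₂ Data.Bool._∧_ (eval-rename f v φ) (eval-rename f v ψ)
eval-rename f v (∘ φ)   = refl

Tautology-rename : ∀ (f : X → Y) φ → Tautology φ → Tautology (rename f φ)
Tautology-rename f φ t v = trans (eval-rename f v φ) (t _)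

-- Propositional reasoning

infix 4 _⊩_ _⊨ᵖ_

-- A record, so that unification can recover `v` and `φ`, which the reducible term `eval v φ` would
-- lose.
record _⊩_ {X : Set x} (v : Form X → Bool) (φ : Form X) : Set where
  constructor ⟨_⟩
  field holds : eval v φ ≡ true
open _⊩_

_⊨ᵖ_ : Form X → Form X → Set _
φ ⊨ᵖ ψ = ∀ v → v ⊩ φ → v ⊩ ψ

module _ {X : Set x} {v : Form X → Bool} where

  ⊩? : ∀ φ → Dec (v ⊩ φ)
  ⊩? φ with eval v φ in eq
  ... | true  = yes ⟨ eq ⟩
  ... | false = no λ { ⟨ t ⟩ → contradiction (trans (sym eq) t) λ () }

  ~⁺ : ¬ v ⊩ φ → v ⊩ ~ φ
  ~⁺ {φ} n with eval v φ in eq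
  ... | true  = contradiction ⟨ eq ⟩ n
  ... | false = ⟨ cong not eq ⟩

  ~⁻ : v ⊩ ~ φ → ¬ v ⊩ φ
  ~⁻ ⟨ n ⟩ ⟨ t ⟩ = contradiction (trans (sym n) (cong not t)) λ ()

  ∧⁺ : v ⊩ φ → v ⊩ ψ → v ⊩ φ ∧ ψ
  ∧⁺ ⟨ s ⟩ ⟨ t ⟩ = ⟨ cong₂ Data.Bool._∧_ s t ⟩

  ∧⁻ : v ⊩ φ ∧ ψ → v ⊩ φ × v ⊩ ψ
  ∧⁻ {φ} {ψ} ⟨ t ⟩ with true ← eval v φ in s = ⟨ s ⟩ , ⟨ t ⟩

  ⇒⁺ : (v ⊩ φ → v ⊩ ψ) → v ⊩ φ ⇒ ψ
  ⇒⁺ f = ~⁺ λ t → let s , n = ∧⁻ t in ~⁻ n (f s)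

  ⇒⁻ : v ⊩ φ ⇒ ψ → v ⊩ φ → v ⊩ ψ
  ⇒⁻ {ψ = ψ} f s = decidable-stable (⊩? ψ) λ n → ~⁻ f (∧⁺ s (~⁺ n))

⊩-top : ∀ {v} (r : X) → v ⊩ top r
⊩-top r = ~⁺ λ t → let s , n = ∧⁻ t in ~⁻ n s

-- Theories and logics

record Theory {X : Set x} (T : Pred (Form X) ℓ) : Set (x Level.⊔ ℓ) where
  field
    tautology : ∀ {φ} → Tautology φ → φ ∈ T
    detach    : ∀ {φ ψ} → φ ⇒ ψ ∈ T → φ ∈ T → ψ ∈ T

  ⊨ᵖ⇒∈ : φ ⊨ᵖ ψ → φ ⇒ ψ ∈ T
  ⊨ᵖ⇒∈ h = tautology λ v → holds (⇒⁺ (h v))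

  infer₁ : φ ⊨ᵖ ψ → φ ∈ T → ψ ∈ T
  infer₁ h = detach (⊨ᵖ⇒∈ h)

  infer₂ : (∀ v → v ⊩ φ → v ⊩ ψ → v ⊩ χ) → φ ∈ T → ψ ∈ T → χ ∈ T
  infer₂ h s t = detach (infer₁ (λ v a → ⇒⁺ (h v a)) s) t

-- Axiom schemes take the place of closure under substitution: in this form the notion survives
-- pulling back along a renaming that may identify variables.
record Logic {X : Set x} (L : Pred (Form X) ℓ) : Set (x Level.⊔ ℓ) where
  field
    theory : Theory L
    ∘-mono : ∀ {φ ψ} → φ ⇒ ψ ∈ L → ∘ φ ∧ φ ⇒ ∘ ψ ∈ L
    ∘-top  : ∀ {r} → ∘ top r ∈ L
    ~⇒∘    : ∀ {φ} → ~ φ ⇒ ∘ φ ∈ L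
    ∘-∧    : ∀ {φ ψ} → ∘ φ ∧ ∘ ψ ⇒ ∘ (φ ∧ ψ) ∈ L
    ∘-sym  : ∀ {φ} → φ ⇒ ∘ (∘ ~ φ ⇒ φ) ∈ L
  open Theory theory public

Logic-rename : ∀ {L : Pred (Form Y) ℓ} (f : X → Y) → Logic L → Logic (λ φ → rename f φ ∈ L)
Logic-rename f logic = record
  { theory = record
    { tautology = λ {φ} t → tautology (Tautology-rename f φ t)
    ; detach    = detach
    }
  ; ∘-mono = ∘-mono
  ; ∘-top  = ∘-top
  ; ~⇒∘    = ~⇒∘
  ; ∘-∧    = ∘-∧
  ; ∘-sym  = ∘-sym
  }
  where open Logic logic

-- Derivations

module _ {P : Set ℓ} {Ax Γ : Pred (Form P) ℓ} where

  Step-mono : ∀ {φs ψs} → (∀ {χ} → χ ∈ˡ φs → χ ∈ˡ ψs) → Step Ax Γ φs ⊆ Step Ax Γ ψs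
  Step-mono inc (axiom a σ) = axiom a σ
  Step-mono inc (hyp h)     = hyp h
  Step-mono inc (sub m σ)   = sub (inc m) σ
  Step-mono inc (mp m n)    = mp (inc m) (inc n)
  Step-mono inc (mono m)    = mono (inc m)

  ++-Derivation : ∀ {φs ψs} → Derivation Ax Γ φs → Derivation Ax Γ ψs → Derivation Ax Γ (φs ++ ψs)
  ++-Derivation []      e = e
  ++-Derivation (s ∷ d) e = Step-mono ∈-++⁺ˡ s ∷ ++-Derivation d e

  ⊢-hyp : φ ∈ Γ → Γ ⊢[ Ax ] φ
  ⊢-hyp h = _ , hyp h ∷ []

  ⊢-axiom : φ ∈ Ax → ∀ σ → Γ ⊢[ Ax ] φ [ σ ]
  ⊢-axiom a σ = _ , axiom a σ ∷ []

  ⊢-sub : Γ ⊢[ Ax ] φ → ∀ σ → Γ ⊢[ Ax ] φ [ σ ]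
  ⊢-sub (_ , d) σ = _ , sub (here refl) σ ∷ d

  ⊢-mp : Γ ⊢[ Ax ] φ ⇒ ψ → Γ ⊢[ Ax ] φ → Γ ⊢[ Ax ] ψ
  ⊢-mp (φs , d) (_ , e) = _ , mp (here refl) (∈-++⁺ʳ (_ ∷ φs) (here refl)) ∷ ++-Derivation d e

  ⊢-mono : Γ ⊢[ Ax ] φ ⇒ ψ → Γ ⊢[ Ax ] ∘ φ ∧ φ ⇒ ∘ ψ
  ⊢-mono (_ , d) = _ , mono (here refl) ∷ d

-- Enumeration of the formulas over ℕ

-- Keeping the previous list makes the lists cumulative, so both halves of a conjunction occur in a
-- common one.
formulas : ℕ → List (Form ℕ)
formulas zero    = []
formulas (suc n) =
  formulas n ++ var n ∷ map ~_ φs ++ map ∘_ φs ++ cartesianProductWith _∧_ φs φs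
  where φs = formulas n

formulas-mono : ∀ {m n} → m ≤ n → φ ∈ˡ formulas m → φ ∈ˡ formulas n
formulas-mono m≤n = go (≤⇒≤′ m≤n)
  where
  go : ∀ {m n} → m ≤′ n → φ ∈ˡ formulas m → φ ∈ˡ formulas n
  go (≤′-reflexive refl) i = i
  go (≤′-step m≤n)       i = ∈-++⁺ˡ (go m≤n i)

formulas-complete : ∀ φ → ∃ λ n → φ ∈ˡ formulas n
formulas-complete (var r) = suc r , ∈-++⁺ʳ (formulas r) (here refl)
formulas-complete (~ φ) =
  let n , i = formulas-complete φ
  in suc n , ∈-++⁺ʳ (formulas n) (there (∈-++⁺ˡ (∈-map⁺ ~_ i)))
formulas-complete (φ ∧ ψ) =
  let m , i = formulas-complete φ
      n , j = formulas-complete ψ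
      φs    = formulas (m ⊔ n)
  in suc (m ⊔ n) ,
     ∈-++⁺ʳ φs (there (∈-++⁺ʳ (map ~_ φs) (∈-++⁺ʳ (map ∘_ φs)
       (∈-cartesianProductWith⁺ _∧_ (formulas-mono (m≤m⊔n m n) i) (formulas-mono (m≤n⊔m m n) j)))))
formulas-complete (∘ φ) =
  let n , i = formulas-complete φ
      φs    = formulas n
  in suc n , ∈-++⁺ʳ φs (there (∈-++⁺ʳ (map ~_ φs) (∈-++⁺ˡ (∈-map⁺ ∘_ i))))

-- Naming the variables in a list

nth : X → List X → ℕ → X
nth d []       _       = d
nth d (r ∷ rs) zero    = r
nth d (r ∷ rs) (suc n) = nth d rs n

position : ∀ {r : X} {rs} → r ∈ˡ rs → ℕ
position (here _)  = zero
position (there i) = suc (position i)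

nth-position : ∀ d {r : X} {rs} (i : r ∈ˡ rs) → nth d rs (position i) ≡ r
nth-position d (here eq) = sym eq
nth-position d (there i) = nth-position d i

module Classical (em : ∀ {a} → ExcludedMiddle a) where

  -- Lindenbaum's lemma

  module Lindenbaum {T : Pred (Form ℕ) ℓ} (theory : Theory T) {φ : Form ℕ} (φ∉T : ¬ φ ∈ T) where
    open Theory theory

    -- Here `α` is the conjunction of all choices made so far; `χ` is negated exactly when adding it
    -- would make `φ` follow.
    decide : Form ℕ → Form ℕ → Form ℕ
    decide α χ with em {P = α ∧ χ ⇒ φ ∈ T}
    ... | yes _ = α ∧ ~ χ
    ... | no  _ = α ∧ χ

    decide-⊨ : ∀ α χ → decide α χ ⊨ᵖ α
    decide-⊨ α χ v t with em {P = α ∧ χ ⇒ φ ∈ T}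
    ... | yes _ = proj₁ (∧⁻ t)
    ... | no  _ = proj₁ (∧⁻ t)

    decide-decides : ∀ α χ → decide α χ ⊨ᵖ χ ⊎ decide α χ ⊨ᵖ ~ χ
    decide-decides α χ with em {P = α ∧ χ ⇒ φ ∈ T}
    ... | yes _ = inj₂ λ v t → proj₂ (∧⁻ t)
    ... | no  _ = inj₁ λ v t → proj₂ (∧⁻ t)

    -- When `χ` is negated, `α ∧ χ` already yields `φ`; if `α ∧ ~ χ` did too, then so would `α`, by
    -- cases on `χ`.
    decide-∉ : ∀ α χ → ¬ α ⇒ φ ∈ T → ¬ decide α χ ⇒ φ ∈ T
    decide-∉ α χ α∉ t with em {P = α ∧ χ ⇒ φ ∈ T}
    ... | no  n = n t
    ... | yes s = α∉ (infer₂ cases s t)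
      where
      cases : ∀ v → v ⊩ α ∧ χ ⇒ φ → v ⊩ α ∧ ~ χ ⇒ φ → v ⊩ α ⇒ φ
      cases v f g = ⇒⁺ λ a → split a (⊩? χ)
        where
        split : v ⊩ α → Dec (v ⊩ χ) → v ⊩ φ
        split a (yes c) = ⇒⁻ f (∧⁺ a c)
        split a (no ¬c) = ⇒⁻ g (∧⁺ a (~⁺ ¬c))

    decideAll : Form ℕ → List (Form ℕ) → Form ℕ
    decideAll α []       = α
    decideAll α (χ ∷ χs) = decideAll (decide α χ) χs

    decideAll-⊨ : ∀ α χs → decideAll α χs ⊨ᵖ α
    decideAll-⊨ α []       v t = t
    decideAll-⊨ α (χ ∷ χs) v t = decide-⊨ α χ v (decideAll-⊨ (decide α χ) χs v t)

    decideAll-decides : ∀ α χs {χ} → χ ∈ˡ χs → decideAll α χs ⊨ᵖ χ ⊎ decideAll α χs ⊨ᵖ ~ χ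
    decideAll-decides α (χ ∷ χs) (here refl) with decide-decides α χ
    ... | inj₁ h = inj₁ λ v t → h v (decideAll-⊨ (decide α χ) χs v t)
    ... | inj₂ h = inj₂ λ v t → h v (decideAll-⊨ (decide α χ) χs v t)
    decideAll-decides α (χ ∷ χs) (there i) = decideAll-decides (decide α χ) χs i

    decideAll-∉ : ∀ α χs → ¬ α ⇒ φ ∈ T → ¬ decideAll α χs ⇒ φ ∈ T
    decideAll-∉ α []       α∉ = α∉
    decideAll-∉ α (χ ∷ χs) α∉ = decideAll-∉ (decide α χ) χs (decide-∉ α χ α∉)

    -- Each stage settles a whole finite list, so no coding of formulas by single numbers is needed.
    stage : ℕ → Form ℕ
    stage zero    = top zero
    stage (suc n) = decideAll (stage n) (formulas n)

    stage-⊨ : ∀ {m n} → m ≤ n → stage n ⊨ᵖ stage m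
    stage-⊨ m≤n = go (≤⇒≤′ m≤n)
      where
      go : ∀ {m n} → m ≤′ n → stage n ⊨ᵖ stage m
      go (≤′-reflexive refl)   v t = t
      go (≤′-step {n = n} m≤n) v t = go m≤n v (decideAll-⊨ (stage n) (formulas n) v t)

    stage-∉ : ∀ n → ¬ stage n ⇒ φ ∈ T
    stage-∉ zero    t = φ∉T (infer₁ (λ v f → ⇒⁻ f (⊩-top zero)) t)
    stage-∉ (suc n) = decideAll-∉ (stage n) (formulas n) (stage-∉ n)

    -- The maximal consistent set under construction: the deductive closure of `T` and all stages.
    Limit : Pred (Form ℕ) ℓ
    Limit χ = ∃ λ n → stage n ⇒ χ ∈ T

    -- Later stages entail earlier ones, so two premises can be brought to the stage `m ⊔ n`.
    Limit-join : ∀ {α β χ} → (∀ v → v ⊩ α → v ⊩ β → v ⊩ χ) →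
                 α ∈ Limit → β ∈ Limit → χ ∈ Limit
    Limit-join h (m , s) (n , t) = m ⊔ n , infer₂
      (λ v f g → ⇒⁺ λ a →
        h v (⇒⁻ f (stage-⊨ (m≤m⊔n m n) v a)) (⇒⁻ g (stage-⊨ (m≤n⊔m m n) v a)))
      s t

    Limit-weaken : ψ ⊨ᵖ χ → ψ ∈ Limit → χ ∈ Limit
    Limit-weaken h s = Limit-join (λ v a _ → h v a) s s

    Limit-consistent : χ ∈ Limit → ¬ ~ χ ∈ Limit
    Limit-consistent s t =
      let n , u = Limit-join (λ v c ¬c → contradiction c (~⁻ ¬c)) s t in stage-∉ n u

    Limit-complete : ∀ χ → ¬ χ ∈ Limit → ~ χ ∈ Limit
    Limit-complete χ χ∉ =
      let n , i = formulas-complete χ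
      in case n (decideAll-decides (stage n) (formulas n) i)
      where
      case : ∀ n → stage (suc n) ⊨ᵖ χ ⊎ stage (suc n) ⊨ᵖ ~ χ → ~ χ ∈ Limit
      case n (inj₁ h) = contradiction (suc n , ⊨ᵖ⇒∈ h) χ∉
      case n (inj₂ h) = suc n , ⊨ᵖ⇒∈ h

    valuation : Form ℕ → Bool
    valuation χ = does (em {P = χ ∈ Limit})

    valuation⇔ : ∀ χ → valuation χ ≡ true ⇔ χ ∈ Limit
    valuation⇔ χ with em {P = χ ∈ Limit}
    ... | yes t = mk⇔ (λ _ → t) (λ _ → refl)
    ... | no  n = mk⇔ (λ ()) (λ t → contradiction t n)

    -- Variables and formulas `∘ χ` are atoms for `eval`, so there `valuation` decides by
    -- definition; negation rests on consistency and completeness of `Limit`.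
    ⊩⇔Limit : ∀ χ → valuation ⊩ χ ⇔ χ ∈ Limit
    ⊩⇔Limit (var r) = mk⇔ (to (valuation⇔ _) ∘′ holds) (⟨_⟩ ∘′ from (valuation⇔ _))
    ⊩⇔Limit (~ χ) = mk⇔
      (λ t → Limit-complete χ (~⁻ t ∘′ from (⊩⇔Limit χ)))
      (λ t → ~⁺ λ s → Limit-consistent (to (⊩⇔Limit χ) s) t)
    ⊩⇔Limit (χ ∧ ω) = mk⇔
      (λ t → let a , b = ∧⁻ t in
             Limit-join (λ v → ∧⁺) (to (⊩⇔Limit χ) a) (to (⊩⇔Limit ω) b))
      (λ t → ∧⁺ (from (⊩⇔Limit χ) (Limit-weaken (λ v → proj₁ ∘′ ∧⁻) t))
                (from (⊩⇔Limit ω) (Limit-weaken (λ v → proj₂ ∘′ ∧⁻) t)))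
    ⊩⇔Limit (∘ χ) = mk⇔ (to (valuation⇔ _) ∘′ holds) (⟨_⟩ ∘′ from (valuation⇔ _))

    extends : χ ∈ T → valuation ⊩ χ
    extends t = from (⊩⇔Limit _) (zero , infer₁ (λ v c → ⇒⁺ λ _ → c) t)

    refutes : ¬ valuation ⊩ φ
    refutes t = let n , s = to (⊩⇔Limit φ) t in stage-∉ n s

  lindenbaum : ∀ {T : Pred (Form ℕ) ℓ} → Theory T → ¬ φ ∈ T →
               Σ[ v ∈ (Form ℕ → Bool) ] (∀ {χ} → χ ∈ T → v ⊩ χ) × ¬ v ⊩ φ
  lindenbaum theory φ∉T = valuation , extends , refutes
    where open Lindenbaum theory φ∉T

  -- The canonical model

  module Canonical {P : Set ℓ} (i : P → ℕ) {L : Pred (Form ℕ) ℓ} (logic : Logic L) where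
    open Logic logic

    record World : Set ℓ where
      field
        val      : Form ℕ → Bool
        verifies : ∀ {φ} → φ ∈ L → val ⊩ φ
    open World

    Sees : World → World → Set
    Sees w u = ∀ {χ} → val w ⊩ ∘ χ → val w ⊩ χ → val u ⊩ χ

    -- Suppose `u` verifies `∘ χ` and `χ`, but `w` refutes `χ`. Axiom `B` for `~ χ` gives
    -- `∘ (∘ ~ ~ χ ⇒ ~ χ)` at `w`, where the inner implication also holds, so `u` verifies that
    -- implication. Monotonicity gives `∘ ~ ~ χ` at `u`, hence `~ χ`, a contradiction.
    Sees-sym : ∀ {w u} → Sees w u → Sees u w
    Sees-sym {w} {u} wu {χ} ∘χ t = decidable-stable (⊩? χ) λ n →
      let nec : val w ⊩ ∘ (∘ ~ ~ χ ⇒ ~ χ)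
          nec = ⇒⁻ (verifies w ∘-sym) (~⁺ n)
          ∘~~χ : val u ⊩ ∘ ~ ~ χ
          ∘~~χ = ⇒⁻ (verifies u (∘-mono (⊨ᵖ⇒∈ λ v c → ~⁺ λ ¬c → ~⁻ ¬c c))) (∧⁺ ∘χ t)
      in ~⁻ (⇒⁻ (wu nec (⇒⁺ λ _ → ~⁺ n)) ∘~~χ) t

    -- What every world seen by `w` has to verify. One `ψ` suffices instead of a finite conjunction,
    -- because `∘-∧` merges two of them.
    Inherited : World → Pred (Form ℕ) ℓ
    Inherited w χ = ∃ λ ψ → (val w ⊩ ∘ ψ × val w ⊩ ψ) × ψ ⇒ χ ∈ L

    Inherited-⊇L : ∀ w → L ⊆ Inherited w
    Inherited-⊇L w t =
      top zero , (verifies w ∘-top , ⊩-top zero) , infer₁ (λ v c → ⇒⁺ λ _ → c) t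

    Inherited-theory : ∀ w → Theory (Inherited w)
    Inherited-theory w = record
      { tautology = λ {φ} t → Inherited-⊇L w {φ} (tautology t)
      ; detach    = λ { (α , (∘α , a) , s) (β , (∘β , b) , t) →
                 α ∧ β , (⇒⁻ (verifies w ∘-∧) (∧⁺ ∘α ∘β) , ∧⁺ a b) ,
                 infer₂ (λ v f g → ⇒⁺ λ ab → let a , b = ∧⁻ ab in ⇒⁻ (⇒⁻ f a) (⇒⁻ g b)) s t }
      }

    -- Were `χ` inherited through some `ψ`, the `∘` rule applied to `ψ ⇒ χ` would give `∘ χ` at `w`.
    -- So `lindenbaum` can refute `χ` while keeping everything inherited.
    ∘-witness : ∀ w χ → ¬ val w ⊩ ∘ χ → Σ[ u ∈ World ] Sees w u × ¬ val u ⊩ χ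
    ∘-witness w χ ¬∘χ =
      let v , inherits , ¬χ = lindenbaum (Inherited-theory w) χ∉
      in record { val = v ; verifies = inherits ∘′ Inherited-⊇L w } ,
         (λ {ψ} ∘ψ t → inherits (ψ , (∘ψ , t) , ⊨ᵖ⇒∈ λ _ → id)) , ¬χ
      where
      χ∉ : ¬ χ ∈ Inherited w
      χ∉ (ψ , (∘ψ , t) , s) = ¬∘χ (⇒⁻ (verifies w (∘-mono s)) (∧⁺ ∘ψ t))

    model : World → Model P
    model w = record
      { frame = record { S = World ; nonempty = w ; R = λ w u → Lift ℓ (Sees w u) }
      ; V     = λ r w → Lift ℓ (val w ⊩ var (i r))
      }

    symmetric : ∀ w₀ → Model.frame (model w₀) ∈ SymmetricFrame
    symmetric w₀ {w} {u} (lift wu) = lift (λ {χ} → Sees-sym {w} {u} wu {χ})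

    truth : ∀ w₀ φ w → (model w₀ , w ⊨ φ) ⇔ (val w ⊩ rename i φ)
    truth w₀ (var r) w = mk⇔ lower lift
    truth w₀ (~ φ) w = mk⇔
      (λ n → ~⁺ (n ∘′ from (truth w₀ φ w)))
      (λ n → ~⁻ n ∘′ to (truth w₀ φ w))
    truth w₀ (φ ∧ ψ) w = mk⇔
      (λ (s , t) → ∧⁺ (to (truth w₀ φ w) s) (to (truth w₀ ψ w) t))
      (λ t → let a , b = ∧⁻ t in from (truth w₀ φ w) a , from (truth w₀ ψ w) b)
    truth w₀ (∘ φ) w = mk⇔
      (λ f → decidable-stable (⊩? _) λ n →
        let u , wu , ¬φ = ∘-witness w _ n
            -- A world refuting the argument of `∘` would verify the `∘` formula by `~⇒∘`, against
            -- `n`.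
            s = decidable-stable (⊩? _) λ ¬s → n (⇒⁻ (verifies w ~⇒∘) (~⁺ ¬s))
        in ¬φ (to (truth w₀ φ u) (f (from (truth w₀ φ w) s) u (lift λ {χ} → wu {χ}))))
      (λ t s u wu → from (truth w₀ φ u) (lower wu t (to (truth w₀ φ w) s)))

  -- Strong completeness

  module _ {P : Set ℓ} {p q : P} (p≢q : p ≢ q) where

    -- A single substitution that fills `p` and `q` independently, for instances of the axiom `∘∧`.
    pair : Form P → Form P → P → Form P
    pair φ ψ r with em {P = r ≡ p}
    ... | yes _ = φ
    ... | no  _ = ψ

    pair-p : pair φ ψ p ≡ φ
    pair-p with em {P = p ≡ p}
    ... | yes _ = refl
    ... | no  n = contradiction refl n

    pair-q : pair φ ψ q ≡ ψ
    pair-q with em {P = q ≡ p}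
    ... | yes q≡p = contradiction (sym q≡p) p≢q
    ... | no  _   = refl

    ⊢-logic : ∀ (Γ : Pred (Form P) ℓ) → Logic (Γ ⊢[ KB° p q ]_)
    ⊢-logic Γ = record
      { theory = record
        { tautology = λ {φ} t →
            -- Axioms enter derivations only as instances; the identity substitution recovers the
            -- tautology itself.
            subst (Γ ⊢[ KB° p q ]_) ([]-id φ (λ _ → refl)) (⊢-axiom (k° (taut {φ = φ} t)) var)
        ; detach    = ⊢-mp
        }
      ; ∘-mono = ⊢-mono
      ; ∘-top  = λ {r} → ⊢-axiom (k° ∘⊤) (λ _ → var r)
      ; ~⇒∘    = λ {φ} → ⊢-axiom (k° ¬→∘) (λ _ → φ)
      ; ∘-∧    = λ {φ} {ψ} →
          subst (Γ ⊢[ KB° p q ]_)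
            (cong₂ (λ α β → ∘ α ∧ ∘ β ⇒ ∘ (α ∧ β)) pair-p pair-q)
            (⊢-axiom (k° ∘∧) (pair φ ψ))
      ; ∘-sym  = λ {φ} → ⊢-axiom B (λ _ → φ)
      }

    completeness : ∀ (Γ : Pred (Form P) ℓ) φ → Γ ⊨[ SymmetricFrame ] φ → Γ ⊢[ KB° p q ] φ
    completeness Γ φ Γ⊨φ = decidable-stable em λ φ∉L →
      let v , verifies , v⊮φ = lindenbaum (Logic.theory logic) (φ∉L ∘′ subst (_∈ L) φ-id)
          w = record { val = v ; verifies = verifies }
      in v⊮φ (to (truth w φ w) (Γ⊨φ (model w) (λ {s} {t} → symmetric w {s} {t}) w λ γ γ∈Γ →
           -- Substitution turns `γ` into its instance under `denote ∘′ name`, which is derivable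
           -- from `Γ`; hence the renamed `γ` lies in the pulled-back logic and holds at `w`.
           from (truth w γ w) (verifies (subst (_∈ L) (sym (rename-∘ denote name γ))
             (⊢-sub (⊢-hyp γ∈Γ) (var ∘′ denote ∘′ name))))))
      where
      L : Pred (Form P) ℓ
      L = Γ ⊢[ KB° p q ]_

      denote : ℕ → P
      denote = nth p (vars φ)

      -- A variable outside `φ` gets the number `zero`, and so is replaced by the first variable of
      -- `φ` when read back.
      name : P → ℕ
      name r with em {P = r ∈ˡ vars φ}
      ... | yes i = position i
      ... | no  _ = zero

      denote-name : ∀ {r} → r ∈ˡ vars φ → denote (name r) ≡ r
      denote-name {r} r∈ with em {P = r ∈ˡ vars φ}
      ... | yes i = nth-position p i
      ... | no  n = contradiction r∈ n

      φ-id : rename denote (rename name φ) ≡ φ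
      φ-id = trans (rename-∘ denote name φ) ([]-id φ (cong var ∘′ denote-name))

      logic = Logic-rename denote (⊢-logic Γ)

      open Canonical name logic

  -- Soundness

  module _ {P : Set ℓ} where

    ⊨-⇒⁻ : ∀ (M : Model P) {s} φ ψ → M , s ⊨ φ ⇒ ψ → M , s ⊨ φ → M , s ⊨ ψ
    ⊨-⇒⁻ M φ ψ f a = decidable-stable em λ n → f (a , n)

    module _ (M : Model P) (s : Model.S M) where

      truthValue : Form P → Bool
      truthValue φ = does (em {P = M , s ⊨ φ})

      truthValue⇔ : ∀ φ → truthValue φ ≡ true ⇔ M , s ⊨ φ
      truthValue⇔ φ with em {P = M , s ⊨ φ}
      ... | yes t = mk⇔ (λ _ → t) (λ _ → refl)
      ... | no  n = mk⇔ (λ ()) (λ t → contradiction t n)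

      ⊩⇔⊨ : ∀ φ → truthValue ⊩ φ ⇔ M , s ⊨ φ
      ⊩⇔⊨ (var r) = mk⇔ (to (truthValue⇔ (var r)) ∘′ holds) (⟨_⟩ ∘′ from (truthValue⇔ (var r)))
      ⊩⇔⊨ (~ φ)   = mk⇔ (λ t → ~⁻ t ∘′ from (⊩⇔⊨ φ)) (λ n → ~⁺ (n ∘′ to (⊩⇔⊨ φ)))
      ⊩⇔⊨ (φ ∧ ψ) = mk⇔
        (λ t → let a , b = ∧⁻ t in to (⊩⇔⊨ φ) a , to (⊩⇔⊨ ψ) b)
        (λ (a , b) → ∧⁺ (from (⊩⇔⊨ φ) a) (from (⊩⇔⊨ ψ) b))
      ⊩⇔⊨ (∘ φ)   = mk⇔ (to (truthValue⇔ (∘ φ)) ∘′ holds) (⟨_⟩ ∘′ from (truthValue⇔ (∘ φ)))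

    -- Moves a substitution from the formula into the valuation; the frame, and with it symmetry, is
    -- unchanged.
    reinterpret : Model P → (P → Form P) → Model P
    reinterpret M σ = record { frame = Model.frame M ; V = λ r s → M , s ⊨ σ r }

    ⊨-[] : ∀ M σ φ s → (M , s ⊨ φ [ σ ]) ⇔ (reinterpret M σ , s ⊨ φ)
    ⊨-[] M σ (var r) s = mk⇔ id id
    ⊨-[] M σ (~ φ)   s = mk⇔ (_∘′ from (⊨-[] M σ φ s)) (_∘′ to (⊨-[] M σ φ s))
    ⊨-[] M σ (φ ∧ ψ) s = mk⇔
      (λ (a , b) → to (⊨-[] M σ φ s) a , to (⊨-[] M σ ψ s) b)
      (λ (a , b) → from (⊨-[] M σ φ s) a , from (⊨-[] M σ ψ s) b)
    ⊨-[] M σ (∘ φ)   s = mk⇔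
      (λ f a t st → to (⊨-[] M σ φ t) (f (from (⊨-[] M σ φ s) a) t st))
      (λ f a t st → from (⊨-[] M σ φ t) (f (to (⊨-[] M σ φ s) a) t st))

    Valid : Form P → Set _
    Valid = ValidOn SymmetricFrame

    valid-[] : ∀ σ φ → Valid φ → Valid (φ [ σ ])
    valid-[] σ φ valid M sy s = from (⊨-[] M σ φ s) (valid (reinterpret M σ) sy s)

    KB°-valid : ∀ {p q φ} → φ ∈ KB° p q → Valid φ
    KB°-valid (k° (taut {φ} t)) M _ s = to (⊩⇔⊨ M s φ) ⟨ t _ ⟩
    KB°-valid (k° ∘⊤) M _ s _ t _ (a , n) = n a
    KB°-valid (k° ¬→∘) M _ s (n , ¬∘p) = ¬∘p λ a → contradiction a n
    KB°-valid (k° ∘∧) M _ s ((∘p , ∘q) , ¬∘pq) =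
      ¬∘pq λ (a , b) t st → ∘p a t st , ∘q b t st
    -- If `p` failed at `t`, then `∘ ~ p` there would carry `~ p` back to `s` along the reversed
    -- edge.
    KB°-valid B M sy s (a , ¬∘) = ¬∘ λ _ t st (∘¬p , ¬p) → ∘¬p ¬p s (sy st) a

    -- The induction carries validity on the whole class, since substitution and the `∘` rule do not
    -- preserve truth at a single world.
    Step-valid : ∀ {p q φ φs} → (∀ {ψ} → ψ ∈ˡ φs → Valid ψ) → Step (KB° p q) ∅ φs φ → Valid φ
    Step-valid ih (axiom {φ} a σ) = valid-[] σ φ (KB°-valid a)
    Step-valid ih (hyp ())
    Step-valid ih (sub {φ} i σ) = valid-[] σ φ (ih i)
    Step-valid ih (mp {φ} {ψ} i j) M sy s = ⊨-⇒⁻ M φ ψ (ih i M sy s) (ih j M sy s)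
    Step-valid ih (mono {φ} {ψ} i) M sy s ((∘φ , a) , ¬∘ψ) =
      ¬∘ψ λ _ t st → ⊨-⇒⁻ M φ ψ (ih i M sy t) (∘φ a t st)

    Derivation-valid : ∀ {p q φs} → Derivation (KB° p q) ∅ φs → ∀ {φ} → φ ∈ˡ φs → Valid φ
    Derivation-valid (s ∷ d) (here refl) = Step-valid (Derivation-valid d) s
    Derivation-valid (s ∷ d) (there i)   = Derivation-valid d i

    soundness : ∀ {p q} φ → ∅ ⊢[ KB° p q ] φ → Valid φ
    soundness φ (_ , d) = Derivation-valid d (here refl)

theorem40 : (∀ {a} → ExcludedMiddle a) →
    ∀ {ℓ} (P : Set ℓ) (p q : P) → p ≢ q →
    (∀ (φ : Form P) → ∅ ⊢[ KB° p q ] φ → ValidOn SymmetricFrame φ)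
    ×
    (∀ (Γ : Pred (Form P) ℓ) (φ : Form P) →
    Γ ⊨[ SymmetricFrame ] φ → Γ ⊢[ KB° p q ] φ)
theorem40 em P p q p≢q = soundness , completeness p≢q
  where open Classical em
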